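{- Let $p,q$ be distinct atoms. With respect to the class of all frames, 1. each of $(+,\square(p\rightharpoonup q)\rightharpoonup(\lozenge p\rightharpoonup⧫ q))$, $(-,(\lozenge p\rightharpoonup⧫ q)\leftharpoondown\square(p\rightharpoonup q))$, $(+,\lozenge p\rightharpoonup⧫ p)$ and $(-,⧫ p\leftharpoondown\lozenge p)$ is a positive definition of the class of all forward confluent frames; 2. each of $(+,(\square p\leftharpoondown\blacksquare q)\rightharpoonup\lozenge(p\leftharpoondown q))$, $(-,\lozenge(p\leftharpoondown q)\leftharpoondown(\square p\leftharpoondown\blacksquare q))$, $(+,\blacksquare p\rightharpoonup\square p)$ and $(-,\square p\leftharpoondown\blacksquare p)$ is a positive definition of the class of all downward confluent frames.
   Context: Syntax. $\mathbf{At}=\{p_i : i\in\mathbb{N}\}$ is a countable set of atoms (enumerated without repetition). The set $\mathbf{Fo}$ of formulas is generated by $A ::= p \mid (A\rightharpoonup A)\mid (A\leftharpoondown A)\mid \top\mid\bot\mid (A\vee A)\mid (A\wedge A)\mid \lozenge A\mid\square A\mid⧫ A\mid\blacksquare A$, with $p\in\mathbf{At}$. Unary connectives bind tightest. A signed formula is a pair $(\alpha,A)$ with $\alpha\in\{+,-\}$ and $A\in\mathbf{Fo}$. Semantics. A frame is a triple $(W,\leq,R)$ where $W\neq\emptyset$, $\leq$ is a preorder on $W$ and $R$ is a binary relation on $W$; $\geq$ is the converse of $\leq$. A valuation is a function $V:\mathbf{At}\to\wp(W)$ such that each $V(p)$ is $\leq$-closed (if $s\in V(p)$ and $s\leq t$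 then $t\in V(p)$). A model based on $(W,\leq,R)$ is $(W,\leq,R,V)$ with $V$ a valuation. Satisfaction at $s\in W$: $s\models p$ iff $s\in V(p)$; $s\models\top$; $s\not\models\bot$; $\vee,\wedge$ as usual pointwise; - $s\models A\rightharpoonup B$ iff for all $t\geq s$, $t\not\models A$ or $t\models B$; - $s\models A\leftharpoondown B$ iff there is $t\leq s$ with $t\not\models A$ and $t\models B$; - $s\models\lozenge A$ iff there are $t\leq s$ and $u$ with $tRu$ and $u\models A$; - $s\models\square A$ iff for all $t\geq s$ and all $u$, $tRu$ implies $u\models A$; - $s\models⧫ A$ iff for all $t\geq s$ there is $u$ with $tRu$ and $u\models A$; - $s\models\blacksquare A$ iff there is $t\leq s$ such that for all $u$, $tRu$ implies $u\models A$. Further, $s\models(+,A)$ iff $s\models A$, and $s\models(-,A)$ iff $s\not\models A$. A signed formula is valid in a frame if it is satisfied at every point of every model based on the frame. Composition: $s(R\circ S)t$ iff there is $u$ with $sRu$ and $uSt$. A frame is forward confluent if ${\geq}\circ R\subseteq R\circ{\geq}$, and downward confluent if ${\leq}\circ R\subseteq R\circ{\leq}$. A signed formula $(\beta,B)$ is a positive definition of a class $\mathcal{C}$ of frames with respect to a class $\mathcal{D}$ of frames if for every frame in $\mathcal{D}$, $(\beta,B)$ is valid in the frame iff the frame is in $\mathcal{C}$. -}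

module Defs where

open import Level using (Level; _⊔_; suc)
open import Data.Nat.Base using (ℕ)
open import Data.Product.Base using (_×_; _,_; ∃-syntax)
open import Data.Sign.Base using (Sign; +; -)
open import Data.Sum.Base using (_⊎_)
open import Function.Base using (flip)
open import Function.Bundles using (_⇔_)
open import Relation.Binary.Construct.Composition using (_;_)
open import Relation.Binary.Core using (Rel; _⇒_)
open import Relation.Binary.Definitions using (_Respects_)
open import Relation.Binary.PropositionalEquality.Core using (_≡_)
open import Relation.Binary.Structures using (IsPreorder)
open import Relation.Nullary.Negation.Core using (¬_)
open import Relation.Unary using (Pred)
import Data.Empty.Polymorphic as Empty
import Data.Unit.Polymorphic.Base as Unit

private
  variable
    ℓ c d : Level

-- The atom pᵢ is represented by its index i.
At : Set
At = ℕ

infixr 9 ◊_ □_ ⧫_ ■_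
infix 6 _∧_ _∨_
infix 5 _⇀_ _↽_

data Fo : Set where
  var         : At → Fo
  _⇀_ _↽_     : Fo → Fo → Fo
  ⊤ ⊥         : Fo
  _∨_ _∧_     : Fo → Fo → Fo
  ◊_ □_ ⧫_ ■_ : Fo → Fo

SignedFormula : Set
SignedFormula = Sign × Fo

record Frame ℓ : Set (suc ℓ) where
  infix 4 _≤_ _≥_
  field
    W          : Set ℓ
    inhabitant : W
    _≤_        : Rel W ℓ
    isPreorder : IsPreorder _≡_ _≤_
    R          : Rel W ℓ

  _≥_ : Rel W ℓ
  _≥_ = flip _≤_

record Valuation (F : Frame ℓ) : Set (suc ℓ) where
  open Frame F
  field
    V      : At → Pred W ℓ
    closed : ∀ p → V p Respects _≤_

record Model ℓ : Set (suc ℓ) where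
  field
    frame     : Frame ℓ
    valuation : Valuation frame
  open Frame frame public
  open Valuation valuation public

infix 4 _,_⊨_ _,_⊨±_

_,_⊨_ : (M : Model ℓ) → Model.W M → Fo → Set ℓ
M , s ⊨ var p = Model.V M p s
M , s ⊨ A ⇀ B = ∀ t → t ≥ s → ¬ (M , t ⊨ A) ⊎ (M , t ⊨ B)
  where open Model M
M , s ⊨ A ↽ B = ∃[ t ] t ≤ s × ¬ (M , t ⊨ A) × (M , t ⊨ B)
  where open Model M
M , s ⊨ ⊤     = Unit.⊤
M , s ⊨ ⊥     = Empty.⊥
M , s ⊨ A ∨ B = (M , s ⊨ A) ⊎ (M , s ⊨ B)
M , s ⊨ A ∧ B = (M , s ⊨ A) × (M , s ⊨ B)
M , s ⊨ ◊ A   = ∃[ t ] ∃[ u ] t ≤ s × R t u × (M , u ⊨ A)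
  where open Model M
M , s ⊨ □ A   = ∀ t → t ≥ s → ∀ u → R t u → M , u ⊨ A
  where open Model M
M , s ⊨ ⧫ A   = ∀ t → t ≥ s → ∃[ u ] R t u × (M , u ⊨ A)
  where open Model M
M , s ⊨ ■ A   = ∃[ t ] t ≤ s × (∀ u → R t u → M , u ⊨ A)
  where open Model M

_,_⊨±_ : (M : Model ℓ) → Model.W M → SignedFormula → Set ℓ
M , s ⊨± (+ , A) = M , s ⊨ A
M , s ⊨± (- , A) = ¬ (M , s ⊨ A)

infix 4 _⊩_

_⊩_ : Frame ℓ → SignedFormula → Set (suc ℓ)
F ⊩ σ = (v : Valuation F) (s : Frame.W F) →
        record { frame = F ; valuation = v } , s ⊨± σ

-- Composition is in diagrammatic order; its symbol is U+037E, not a semicolon.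
ForwardConfluent : Pred (Frame ℓ) ℓ
ForwardConfluent F = (_≥_ ; R) ⇒ (R ; _≥_)
  where open Frame F

DownwardConfluent : Pred (Frame ℓ) ℓ
DownwardConfluent F = (_≤_ ; R) ⇒ (R ; _≤_)
  where open Frame F

PositiveDefinition : SignedFormula → Pred (Frame ℓ) c → Pred (Frame ℓ) d →
                     Set (suc ℓ ⊔ c ⊔ d)
PositiveDefinition {ℓ = ℓ} σ C D = (F : Frame ℓ) → D F → F ⊩ σ ⇔ C F

{-# OPTIONS --safe #-}
-- (+ , A ⇀ B) and (- , B ↽ A) are both valid in a frame exactly when A entails B
-- at every point of every model on it, so the eight claims reduce to four
-- entailments.  Soundness chases points through the confluence square; conversely,
-- it suffices to interpret every atom by one and the same up-set: ↑u for t ≤ s,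
-- t R u (forward), and the up-closure of R(s) (downward).  Then p ⇀ q is true and
-- p ↽ q is false everywhere, so the entailments in p and q reduce to those in p.
module Submission where

open import Defs
open import Axiom.ExcludedMiddle using (ExcludedMiddle)
open import Data.Product.Base using (_×_; _,_; ∃-syntax)
open import Data.Sign.Base using (+; -)
open import Data.Sum.Base using (inj₁; inj₂; fromInj₂)
open import Function.Base using (id)
open import Function.Bundles using (_⇔_; mk⇔)
open import Function.Construct.Composition using (_⇔-∘_)
open import Level using (Level)
open import Relation.Binary.Definitions using (_Respects_)
open import Relation.Binary.PropositionalEquality.Core using (_≢_)
open import Relation.Binary.Structures using (IsPreorder)
open import Relation.Nullary.Decidable.Core using (yes; no; decidable-stable)
open import Relation.Nullary.Negation.Core using (contradiction)
open import Relation.Unary using (Pred; U)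

private
  variable
    ℓ c : Level

infix 6 _▹_

_▹_ : (F : Frame ℓ) → Valuation F → Model ℓ
F ▹ v = record { frame = F ; valuation = v }

Entails : Frame ℓ → Fo → Fo → Set _
Entails F A B = ∀ v s → (F ▹ v , s ⊨ A) → (F ▹ v , s ⊨ B)

module _ (M : Model ℓ) where
  open Model M
  open IsPreorder isPreorder using (refl)

  ⇀-elim : ∀ A B {s} → M , s ⊨ A ⇀ B → M , s ⊨ A → M , s ⊨ B
  ⇀-elim _ _ A⇀B a = fromInj₂ (contradiction a) (A⇀B _ refl)

  -- The clause for `⇀` is a disjunction, so deciding `A` at each point turns an implication into
  -- it.
  ⇀-intro : ExcludedMiddle ℓ → ∀ A B {s} →
            (∀ t → t ≥ s → M , t ⊨ A → M , t ⊨ B) → M , s ⊨ A ⇀ B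
  ⇀-intro em A _ f t s≤t with em {M , t ⊨ A}
  ... | yes a = inj₂ (f t s≤t a)
  ... | no ¬a = inj₁ ¬a

module _ (F : Frame ℓ) where
  open Frame F
  open IsPreorder isPreorder using (refl; trans)

  uniform : (X : Pred W ℓ) → X Respects _≤_ → Valuation F
  uniform X closed = record { V = λ _ → X ; closed = λ _ → closed }

  -- Completeness starts from this weaker hypothesis so that the formulas in two atoms can reuse it:
  -- they are shown to give the one-atom entailment under valuations where the atoms coincide.
  UniformlyEntails : Fo → Fo → Set _
  UniformlyEntails A B = ∀ X (closed : X Respects _≤_) s →
    F ▹ uniform X closed , s ⊨ A → F ▹ uniform X closed , s ⊨ B

  Entails⇒UniformlyEntails : ∀ A B → Entails F A B → UniformlyEntails A B
  Entails⇒UniformlyEntails _ _ h X closed = h (uniform X closed)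

  ◊⇒⧫-sound : ∀ p → ForwardConfluent F → Entails F (◊ var p) (⧫ var p)
  ◊⇒⧫-sound p confluent v s (t , u , t≤s , tRu , u⊨p) s′ s≤s′ =
    let w , s′Rw , u≤w = confluent (t , trans t≤s s≤s′ , tRu)
    in  w , s′Rw , Valuation.closed v p u≤w u⊨p

  ◊⇒⧫-complete : ∀ p → UniformlyEntails (◊ var p) (⧫ var p) → ForwardConfluent F
  ◊⇒⧫-complete _ h {s} {u} (t , t≤s , tRu) =
    -- The path through `t` to `u` gives ◊ at `s`; reading ⧫ at `s` itself yields a successor of `s`
    -- above `u`.
    h (u ≤_) (λ x≤y u≤x → trans u≤x x≤y) s (t , u , t≤s , tRu , refl) s refl

  ■⇒□-sound : ∀ p → DownwardConfluent F → Entails F (■ var p) (□ var p)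
  ■⇒□-sound p confluent v s (t , t≤s , Rt⊨p) s′ s≤s′ u s′Ru =
    let w , tRw , w≤u = confluent (s′ , trans t≤s s≤s′ , s′Ru)
    in  Valuation.closed v p w≤u (Rt⊨p w tRw)

  ■⇒□-complete : ∀ p → UniformlyEntails (■ var p) (□ var p) → DownwardConfluent F
  ■⇒□-complete _ h {s} {u} (t , s≤t , tRu) =
    h (λ x → ∃[ w ] R s w × w ≤ x)
      (λ { x≤y (w , sRw , w≤x) → w , sRw , trans w≤x x≤y })
      -- All successors of `s` lie in the up-closure, so `s` witnesses its own ■; □ then puts `u`
      -- above one of them.
      s (s , refl , λ w sRw → w , sRw , refl) t s≤t u tRu

  module _ (em : ExcludedMiddle ℓ) where

    ⊩+⇔Entails : ∀ A B → F ⊩ (+ , A ⇀ B) ⇔ Entails F A B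
    ⊩+⇔Entails A B = mk⇔
      (λ h v s → ⇀-elim (F ▹ v) A B (h v s))
      (λ h v s → ⇀-intro (F ▹ v) em A B λ t _ → h v t)

    ⊩-⇔Entails : ∀ A B → F ⊩ (- , B ↽ A) ⇔ Entails F A B
    ⊩-⇔Entails A B = mk⇔
      -- Were `B` to fail at `s`, then `s` itself would witness `B ↽ A`.
      (λ h v s a → decidable-stable em λ ¬b → h v s (s , refl , ¬b , a))
      (λ { h v s (t , _ , ¬b , a) → ¬b (h v t a) })

    □⇀⇒◊⇀⧫-sound : ∀ p q → ForwardConfluent F →
      Entails F (□ (var p ⇀ var q)) (◊ var p ⇀ ⧫ var q)
    □⇀⇒◊⇀⧫-sound p q confluent v s p⇀q =
      ⇀-intro (F ▹ v) em (◊ var p) (⧫ var q) λ t s≤t ◊p t′ t≤t′ →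
        -- The one-atom case finds a successor of `t′` satisfying `p`; as `t′` is above `s`, the □
        -- premise carries `p` to `q` there.
        let w , t′Rw , w⊨p = ◊⇒⧫-sound p confluent v t ◊p t′ t≤t′
        in  w , t′Rw , ⇀-elim (F ▹ v) (var p) (var q) (p⇀q t′ (trans s≤t t≤t′) w t′Rw) w⊨p

    □⇀⇒◊⇀⧫-complete : ∀ p q →
      Entails F (□ (var p ⇀ var q)) (◊ var p ⇀ ⧫ var q) → ForwardConfluent F
    □⇀⇒◊⇀⧫-complete p q h = ◊⇒⧫-complete p λ X closed s →
      let M = F ▹ uniform X closed
      in  ⇀-elim M (◊ var p) (⧫ var q) (h (uniform X closed) s
            λ _ _ _ _ → ⇀-intro M em (var p) (var q) λ _ _ → id)

    □↽■⇒◊↽-sound : ∀ p q → DownwardConfluent F →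
      Entails F (□ var p ↽ ■ var q) (◊ (var p ↽ var q))
    □↽■⇒◊↽-sound p q confluent v s (t , t≤s , ¬□p , (t′ , t′≤t , Rt′⊨q)) =
      -- If the conclusion failed, □ p would hold at `t`: were `p` false at `u`, it would be false
      -- at `w` below `u`, where `q` holds, so `w` would witness `p ↽ q`.
      decidable-stable em λ ¬◊ → ¬□p λ t″ t≤t″ u t″Ru →
        let w , t′Rw , w≤u = confluent (t″ , trans t′≤t t≤t″ , t″Ru)
        in  decidable-stable em λ u⊭p →
              ¬◊ (t′ , w , trans t′≤t t≤s , t′Rw , w , refl ,
                  (λ w⊨p → u⊭p (Valuation.closed v p w≤u w⊨p)) , Rt′⊨q w t′Rw)

    □↽■⇒◊↽-complete : ∀ p q →
      Entails F (□ var p ↽ ■ var q) (◊ (var p ↽ var q)) → DownwardConfluent F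
    □↽■⇒◊↽-complete p q h = ■⇒□-complete p λ X closed s ■p →
      -- If □ p failed, `s` would witness the premise of `h`, whose conclusion demands a point both
      -- outside and inside `X`.
      decidable-stable em λ ¬□p →
        let _ , _ , _ , _ , (_ , _ , x∉X , x∈X) = h (uniform X closed) s (s , refl , ¬□p , ■p)
        in  x∉X x∈X

positiveDefinitions : ExcludedMiddle ℓ → (C : Pred (Frame ℓ) c) (A B : Fo) →
  (∀ F → Entails F A B → C F) → (∀ F → C F → Entails F A B) →
  PositiveDefinition (+ , A ⇀ B) C U × PositiveDefinition (- , B ↽ A) C U
positiveDefinitions em C A B complete sound =
  (λ F _ → entails⇔C F ⇔-∘ ⊩+⇔Entails F em A B) ,
  (λ F _ → entails⇔C F ⇔-∘ ⊩-⇔Entails F em A B)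
  where
  entails⇔C : ∀ F → Entails F A B ⇔ C F
  entails⇔C F = mk⇔ (complete F) (sound F)

proposition24 : ∀ {ℓ} → ExcludedMiddle ℓ → ∀ {p q : At} → p ≢ q →
    let P = var p
        Q = var q
        Forward = ForwardConfluent {ℓ}
        Downward = DownwardConfluent {ℓ}
    in
    ( PositiveDefinition (+ , □ (P ⇀ Q) ⇀ (◊ P ⇀ ⧫ Q)) Forward U
    × PositiveDefinition (- , (◊ P ⇀ ⧫ Q) ↽ □ (P ⇀ Q)) Forward U
    × PositiveDefinition (+ , ◊ P ⇀ ⧫ P) Forward U
    × PositiveDefinition (- , ⧫ P ↽ ◊ P) Forward U )
    ×
    ( PositiveDefinition (+ , (□ P ↽ ■ Q) ⇀ ◊ (P ↽ Q)) Downward U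
    × PositiveDefinition (- , ◊ (P ↽ Q) ↽ (□ P ↽ ■ Q)) Downward U
    × PositiveDefinition (+ , ■ P ⇀ □ P) Downward U
    × PositiveDefinition (- , □ P ↽ ■ P) Downward U )
proposition24 em {p} {q} _ =
  let P = var p
      Q = var q
      forward₁ , forward₂ =
        positiveDefinitions em ForwardConfluent (□ (P ⇀ Q)) (◊ P ⇀ ⧫ Q)
          (λ F → □⇀⇒◊⇀⧫-complete F em p q)
          (λ F → □⇀⇒◊⇀⧫-sound F em p q)
      forward₃ , forward₄ =
        positiveDefinitions em ForwardConfluent (◊ P) (⧫ P)
          (λ F h → ◊⇒⧫-complete F p (Entails⇒UniformlyEntails F (◊ P) (⧫ P) h))
          (λ F → ◊⇒⧫-sound F p)
      downward₁ , downward₂ =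
        positiveDefinitions em DownwardConfluent (□ P ↽ ■ Q) (◊ (P ↽ Q))
          (λ F → □↽■⇒◊↽-complete F em p q)
          (λ F → □↽■⇒◊↽-sound F em p q)
      downward₃ , downward₄ =
        positiveDefinitions em DownwardConfluent (■ P) (□ P)
          (λ F h → ■⇒□-complete F p (Entails⇒UniformlyEntails F (■ P) (□ P) h))
          (λ F → ■⇒□-sound F p)
  in  (forward₁ , forward₂ , forward₃ , forward₄) ,
      (downward₁ , downward₂ , downward₃ , downward₄)
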